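{- Let $f:2^{[n]}\to\mathbb{R}_{\ge 0}$ be a monotone proportionally submodular function. Then $f$ is $1$-meta-submodular.
   Context: $[n]=\{1,\dots,n\}$; $S+i=S\cup\{i\}$, $S-i=S\setminus\{i\}$ (operations applied from left to right). A set function $f$ is proportionally submodular if for all $S,T\subseteq[n]$, $|S|f(T)+|T|f(S)\ge|S\cap T|f(S\cup T)+|S\cup T|f(S\cap T)$. It is monotone if $f(S)\le f(T)$ whenever $S\subseteq T$. Define $B_i(S)=f(S+i)-f(S-i)$ and $A_{ij}(S)=B_j(S+i)-B_j(S-i)=f(S+i+j)-f(S+i-j)-f(S-i+j)+f(S-i-j)$ (so $A_{ii}(S)=0$). For $\gamma\ge 0$, $f$ is $\gamma$-meta-submodular if for every nonempty $S\subseteq[n]$ and all $i,j\in[n]$, $A_{ij}(S)\le\gamma\,\frac{B_i(S)+B_j(S)}{|S|}$. -}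

module Defs where

open import Data.Fin.Base using (Fin)
open import Data.Fin.Subset as Subset
  using (Subset; Nonempty; _⊆_; _∩_; _∪_; ⁅_⁆; ∣_∣; inside; outside)
open import Data.Integer.Base using (+_)
open import Data.Nat.Base as ℕ using (ℕ)
import Data.Nat.Properties as ℕ
open import Data.Product.Base using (∃; _,_)
open import Data.Rational.Base as ℚ using (ℚ; 0ℚ; 1ℚ; ½)
import Data.Rational.Properties as ℚ
open import Data.Rational.Solver using (module +-*-Solver)
open import Data.Vec.Base using (_∷_; there)
open import Relation.Binary.PropositionalEquality
  using (_≡_; refl; sym; trans; cong; cong₂; subst)

private
  variable
    n : ℕ

------------------------------------------------------------------------
-- Real numbers: Cauchy sequences of rationals, ordered up to every
-- positive rational error. Equality of reals is `x ≤ y × y ≤ x`, not `_≡_`.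

record ℝ : Set where
  constructor mkℝ
  field
    seq    : ℕ → ℚ
    cauchy : ∀ ε → 0ℚ ℚ.< ε → ∃ λ N → ∀ m k → N ℕ.≤ m → N ℕ.≤ k →
             ℚ.∣ seq m ℚ.- seq k ∣ ℚ.≤ ε

open ℝ public

infix  4 _≤_
infix  8 -_
infixl 7 _*_ _/_
infixl 6 _+_ _-_

_≤_ : ℝ → ℝ → Set
x ≤ y = ∀ ε → 0ℚ ℚ.< ε → ∃ λ N → ∀ k → N ℕ.≤ k → seq x k ℚ.≤ seq y k ℚ.+ ε

private
  module S = +-*-Solver
  open S using (_:+_; _:*_; _:-_; :-_; _:=_)
  open ℚ.≤-Reasoning

  half>0 : ∀ {ε} → 0ℚ ℚ.< ε → 0ℚ ℚ.< ε ℚ.* ½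
  half>0 {ε} ε>0 = ℚ.positive⁻¹ (ε ℚ.* ½) {{ℚ.pos*pos⇒pos ε {{ℚ.positive ε>0}} ½}}

  half+half : ∀ ε → ε ℚ.* ½ ℚ.+ ε ℚ.* ½ ≡ ε
  half+half ε = trans (sym (ℚ.*-distribˡ-+ ε ½ ½)) (ℚ.*-identityʳ ε)

  *-mono : ∀ {p q r s} → 0ℚ ℚ.≤ r → 0ℚ ℚ.≤ q →
           p ℚ.≤ q → r ℚ.≤ s → p ℚ.* r ℚ.≤ q ℚ.* s
  *-mono {p} {q} {r} {s} r≥0 q≥0 p≤q r≤s = ℚ.≤-trans
    (ℚ.*-monoʳ-≤-nonNeg r {{ℚ.nonNegative r≥0}} p≤q)
    (ℚ.*-monoˡ-≤-nonNeg q {{ℚ.nonNegative q≥0}} r≤s)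

fromℚ : ℚ → ℝ
fromℚ q = mkℝ (λ _ → q) λ ε ε>0 → 0 , λ _ _ _ _ →
  subst (λ d → ℚ.∣ d ∣ ℚ.≤ ε) (sym (ℚ.+-inverseʳ q)) (ℚ.<⇒≤ ε>0)

fromℕ : ℕ → ℝ
fromℕ k = fromℚ (+ k ℚ./ 1)

0ℝ 1ℝ : ℝ
0ℝ = fromℕ 0
1ℝ = fromℕ 1

_+_ : ℝ → ℝ → ℝ
seq (x + y) k = seq x k ℚ.+ seq y k
cauchy (x + y) ε ε>0 with cauchy x (ε ℚ.* ½) (half>0 ε>0) | cauchy y (ε ℚ.* ½) (half>0 ε>0)
... | M , hx | N , hy = M ℕ.⊔ N , λ m k m≥ k≥ →
  let a = seq x m ; b = seq y m ; c = seq x k ; d = seq y k in begin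
  ℚ.∣ (a ℚ.+ b) ℚ.- (c ℚ.+ d) ∣
    ≡⟨ cong ℚ.∣_∣ (S.solve 4 (λ a b c d → (a :+ b) :- (c :+ d) := (a :- c) :+ (b :- d)) refl a b c d) ⟩
  ℚ.∣ (a ℚ.- c) ℚ.+ (b ℚ.- d) ∣
    ≤⟨ ℚ.∣p+q∣≤∣p∣+∣q∣ (a ℚ.- c) (b ℚ.- d) ⟩
  ℚ.∣ a ℚ.- c ∣ ℚ.+ ℚ.∣ b ℚ.- d ∣
    ≤⟨ ℚ.+-mono-≤ (hx m k (ℕ.m⊔n≤o⇒m≤o M N m≥) (ℕ.m⊔n≤o⇒m≤o M N k≥))
                  (hy m k (ℕ.m⊔n≤o⇒n≤o M N m≥) (ℕ.m⊔n≤o⇒n≤o M N k≥)) ⟩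
  ε ℚ.* ½ ℚ.+ ε ℚ.* ½
    ≡⟨ half+half ε ⟩
  ε ∎

-_ : ℝ → ℝ
seq (- x) k = ℚ.- seq x k
cauchy (- x) ε ε>0 with cauchy x ε ε>0
... | N , hx = N , λ m k m≥ k≥ → let a = seq x m ; c = seq x k in begin
  ℚ.∣ ℚ.- a ℚ.- ℚ.- c ∣    ≡⟨ cong ℚ.∣_∣ (S.solve 2 (λ a c → :- a :- :- c := :- (a :- c)) refl a c) ⟩
  ℚ.∣ ℚ.- (a ℚ.- c) ∣      ≡⟨ ℚ.∣-p∣≡∣p∣ (a ℚ.- c) ⟩
  ℚ.∣ a ℚ.- c ∣            ≤⟨ hx m k m≥ k≥ ⟩
  ε ∎

_-_ : ℝ → ℝ → ℝ
x - y = x + - y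

private
  record Bound (x : ℝ) : Set where
    field
      B     : ℚ
      from  : ℕ
      B>0   : 0ℚ ℚ.< B
      bound : ∀ k → from ℕ.≤ k → ℚ.∣ seq x k ∣ ℚ.≤ B

  bounded : ∀ x → Bound x
  bounded x with cauchy x 1ℚ (ℚ.positive⁻¹ 1ℚ)
  ... | N , hx = record
    { B     = 1ℚ ℚ.+ ℚ.∣ c ∣
    ; from  = N
    ; B>0   = ℚ.+-mono-<-≤ (ℚ.positive⁻¹ 1ℚ) (ℚ.0≤∣p∣ c)
    ; bound = λ k k≥ → let a = seq x k in begin
        ℚ.∣ a ∣                     ≡⟨ cong ℚ.∣_∣ (S.solve 2 (λ a c → a := (a :- c) :+ c) refl a c) ⟩
        ℚ.∣ (a ℚ.- c) ℚ.+ c ∣       ≤⟨ ℚ.∣p+q∣≤∣p∣+∣q∣ (a ℚ.- c) c ⟩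
        ℚ.∣ a ℚ.- c ∣ ℚ.+ ℚ.∣ c ∣   ≤⟨ ℚ.+-monoˡ-≤ ℚ.∣ c ∣ (hx k N k≥ ℕ.≤-refl) ⟩
        1ℚ ℚ.+ ℚ.∣ c ∣ ∎
    }
    where c = seq x N

  share : ∀ ε B → 0ℚ ℚ.< ε → 0ℚ ℚ.< B → ∃ λ δ → ∃ λ (_ : 0ℚ ℚ.< δ) → δ ℚ.* B ≡ ε ℚ.* ½
  share ε B ε>0 B>0 = e ℚ.* r , ℚ.positive⁻¹ (e ℚ.* r) {{ℚ.pos*pos⇒pos e r}} ,
    trans (ℚ.*-assoc e r B) (trans (cong (e ℚ.*_) (ℚ.*-inverseˡ B)) (ℚ.*-identityʳ e))
    where
    e = ε ℚ.* ½
    instance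
      B⁺ = ℚ.positive B>0
      B≢0 = ℚ.pos⇒nonZero B
      e⁺ = ℚ.positive (half>0 ε>0)
    r = ℚ.1/ B
    instance
      r⁺ = ℚ.1/pos⇒pos B

_*_ : ℝ → ℝ → ℝ
seq (x * y) k = seq x k ℚ.* seq y k
cauchy (x * y) ε ε>0
  with bounded x | bounded y
... | record { B = X ; from = P ; B>0 = X>0 ; bound = bx }
    | record { B = Y ; from = Q ; B>0 = Y>0 ; bound = by }
  with share ε Y ε>0 Y>0 | share ε X ε>0 X>0
... | δ , δ>0 , δY | η , η>0 , ηX
  with cauchy x δ δ>0 | cauchy y η η>0
... | M , hx | N , hy = (P ℕ.⊔ Q) ℕ.⊔ (M ℕ.⊔ N) , λ m k m≥ k≥ →
  let a = seq x m ; b = seq y m ; c = seq x k ; d = seq y k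
      PQ≤m = ℕ.m⊔n≤o⇒m≤o (P ℕ.⊔ Q) (M ℕ.⊔ N) m≥
      PQ≤k = ℕ.m⊔n≤o⇒m≤o (P ℕ.⊔ Q) (M ℕ.⊔ N) k≥
      MN≤m = ℕ.m⊔n≤o⇒n≤o (P ℕ.⊔ Q) (M ℕ.⊔ N) m≥
      MN≤k = ℕ.m⊔n≤o⇒n≤o (P ℕ.⊔ Q) (M ℕ.⊔ N) k≥
  in begin
  ℚ.∣ a ℚ.* b ℚ.- c ℚ.* d ∣
    ≡⟨ cong ℚ.∣_∣ (S.solve 4 (λ a b c d → a :* b :- c :* d := (a :- c) :* d :+ (b :- d) :* a) refl a b c d) ⟩
  ℚ.∣ (a ℚ.- c) ℚ.* d ℚ.+ (b ℚ.- d) ℚ.* a ∣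
    ≤⟨ ℚ.∣p+q∣≤∣p∣+∣q∣ ((a ℚ.- c) ℚ.* d) ((b ℚ.- d) ℚ.* a) ⟩
  ℚ.∣ (a ℚ.- c) ℚ.* d ∣ ℚ.+ ℚ.∣ (b ℚ.- d) ℚ.* a ∣
    ≡⟨ cong₂ ℚ._+_ (ℚ.∣p*q∣≡∣p∣*∣q∣ (a ℚ.- c) d) (ℚ.∣p*q∣≡∣p∣*∣q∣ (b ℚ.- d) a) ⟩
  ℚ.∣ a ℚ.- c ∣ ℚ.* ℚ.∣ d ∣ ℚ.+ ℚ.∣ b ℚ.- d ∣ ℚ.* ℚ.∣ a ∣
    ≤⟨ ℚ.+-mono-≤
         (*-mono (ℚ.0≤∣p∣ d) (ℚ.<⇒≤ δ>0)
           (hx m k (ℕ.m⊔n≤o⇒m≤o M N MN≤m) (ℕ.m⊔n≤o⇒m≤o M N MN≤k))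
           (by k (ℕ.m⊔n≤o⇒n≤o P Q PQ≤k)))
         (*-mono (ℚ.0≤∣p∣ a) (ℚ.<⇒≤ η>0)
           (hy m k (ℕ.m⊔n≤o⇒n≤o M N MN≤m) (ℕ.m⊔n≤o⇒n≤o M N MN≤k))
           (bx m (ℕ.m⊔n≤o⇒m≤o P Q PQ≤m))) ⟩
  δ ℚ.* Y ℚ.+ η ℚ.* X
    ≡⟨ cong₂ ℚ._+_ δY ηX ⟩
  ε ℚ.* ½ ℚ.+ ε ℚ.* ½
    ≡⟨ half+half ε ⟩
  ε ∎

_/_ : ℝ → (k : ℕ) → .{{_ : ℕ.NonZero k}} → ℝ
x / k = x * fromℚ (+ 1 ℚ./ k)

------------------------------------------------------------------------
-- Set functions on an n-element ground set

SetFunction : ℕ → Set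
SetFunction n = Subset n → ℝ

infixl 6 _+ˢ_ _-ˢ_

_+ˢ_ : Subset n → Fin n → Subset n
S +ˢ i = S ∪ ⁅ i ⁆

_-ˢ_ : Subset n → Fin n → Subset n
S -ˢ i = S Subset.- i

NonNegative : SetFunction n → Set
NonNegative f = ∀ S → 0ℝ ≤ f S

Monotone : SetFunction n → Set
Monotone f = ∀ S T → S ⊆ T → f S ≤ f T

ProportionallySubmodular : SetFunction n → Set
ProportionallySubmodular f = ∀ S T →
  fromℕ ∣ S ∩ T ∣ * f (S ∪ T) + fromℕ ∣ S ∪ T ∣ * f (S ∩ T)
    ≤ fromℕ ∣ S ∣ * f T + fromℕ ∣ T ∣ * f S

B : SetFunction n → Fin n → Subset n → ℝ
B f i S = f (S +ˢ i) - f (S -ˢ i)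

A : SetFunction n → Fin n → Fin n → Subset n → ℝ
A f i j S = B f j (S +ˢ i) - B f j (S -ˢ i)

nonempty⇒nonZero : {S : Subset n} → Nonempty S → ℕ.NonZero ∣ S ∣
nonempty⇒nonZero {S = inside  ∷ S} _ = _
nonempty⇒nonZero {S = outside ∷ S} (Fin.suc i , there i∈S) =
  nonempty⇒nonZero (i , i∈S)

MetaSubmodular : ℝ → SetFunction n → Set
MetaSubmodular γ f = ∀ S (S≢∅ : Nonempty S) i j →
  let instance _ = nonempty⇒nonZero S≢∅ in
  A f i j S ≤ γ * ((B f i S + B f j S) / ∣ S ∣)

{-# OPTIONS --safe #-}

-- For i = j the second difference A f i i S vanishes, and monotonicity makes
-- the bound nonnegative. For i ≠ j let R = S ∖ {i , j}, r = ∣ R ∣ and write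
-- a , b , c , d for the values of f at R+i , R+j , R+i+j , R. Proportional
-- submodularity at R+i and R+j reads
--   r c + (r+2) d ≤ (r+1) (a + b),
-- that is r A ≤ (a - d) + (b - d), where A = c - a - b + d. Adding A once or
-- twice to both sides gives (r+1) A ≤ c - d and (r+2) A ≤ (c - a) + (c - b),
-- and these three are the inequalities wanted when S contains none, one or
-- both of i and j.
module Submission where

open import Data.Bool.Base using (Bool; _∧_; _∨_)
open import Data.Bool.Properties using (∨-identityʳ; ∨-zeroʳ)
open import Data.Fin.Base using (Fin; zero; suc)
open import Data.Fin.Properties using (_≟_)
open import Data.Fin.Subset
  using (Subset; inside; outside; _∩_; _∪_; ⁅_⁆; ∣_∣; _⊆_)
open import Data.Fin.Subset.Properties
  using (∪-identityʳ; ∩-idem; ∪-idem; p─⊥≡p; p─q⊆p; p⊆p∪q; ⊆-trans)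
open import Data.Integer.Base as ℤ using (+_)
import Data.Integer.Properties as ℤ
open import Data.Nat.Base as ℕ using (ℕ)
open import Data.Product.Base using (_,_)
open import Data.Rational.Base as ℚ using (ℚ; 0ℚ; 1ℚ; fromℚᵘ; toℚᵘ)
import Data.Rational.Properties as ℚ
open import Data.Rational.Solver using (module +-*-Solver)
open import Data.Rational.Unnormalised.Base as ℚᵘ using (mkℚᵘ)
import Data.Rational.Unnormalised.Properties as ℚᵘ
open import Data.Vec.Base using (Vec; _∷_; _[_]≔_; lookup; zipWith)
open import Data.Vec.Properties
  using ([]≔-commutes; []≔-idempotent; []≔-lookup; lookup∘update′)
open import Function.Base using (_∘_)
open import Relation.Binary.PropositionalEquality
open import Relation.Nullary.Decidable using (yes; no)

open import Defs

open +-*-Solver using (solve; con; _:+_; _:*_; _:-_; _:=_)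

private
  variable
    n : ℕ

-- Natural numbers and their reciprocals as rationals.

fromℚᵘ-homo-+ : ∀ p q → fromℚᵘ (p ℚᵘ.+ q) ≡ fromℚᵘ p ℚ.+ fromℚᵘ q
fromℚᵘ-homo-+ p q = ℚ.toℚᵘ-injective (begin
  toℚᵘ (fromℚᵘ (p ℚᵘ.+ q))                 ≈⟨ ℚ.toℚᵘ-fromℚᵘ (p ℚᵘ.+ q) ⟩
  p ℚᵘ.+ q                                 ≈⟨ ℚᵘ.+-cong (ℚ.toℚᵘ-fromℚᵘ p) (ℚ.toℚᵘ-fromℚᵘ q) ⟨
  toℚᵘ (fromℚᵘ p) ℚᵘ.+ toℚᵘ (fromℚᵘ q)     ≈⟨ ℚ.toℚᵘ-homo-+ (fromℚᵘ p) (fromℚᵘ q) ⟨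
  toℚᵘ (fromℚᵘ p ℚ.+ fromℚᵘ q)             ∎)
  where open ℚᵘ.≃-Reasoning

fromℚᵘ-homo-* : ∀ p q → fromℚᵘ (p ℚᵘ.* q) ≡ fromℚᵘ p ℚ.* fromℚᵘ q
fromℚᵘ-homo-* p q = ℚ.toℚᵘ-injective (begin
  toℚᵘ (fromℚᵘ (p ℚᵘ.* q))                 ≈⟨ ℚ.toℚᵘ-fromℚᵘ (p ℚᵘ.* q) ⟩
  p ℚᵘ.* q                                 ≈⟨ ℚᵘ.*-cong (ℚ.toℚᵘ-fromℚᵘ p) (ℚ.toℚᵘ-fromℚᵘ q) ⟨
  toℚᵘ (fromℚᵘ p) ℚᵘ.* toℚᵘ (fromℚᵘ q)     ≈⟨ ℚ.toℚᵘ-homo-* (fromℚᵘ p) (fromℚᵘ q) ⟨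
  toℚᵘ (fromℚᵘ p ℚ.* fromℚᵘ q)             ∎)
  where open ℚᵘ.≃-Reasoning

suc/1 : ∀ m → + ℕ.suc m ℚ./ 1 ≡ 1ℚ ℚ.+ + m ℚ./ 1
suc/1 m = trans
  -- The unnormalised sum 1/1 + m/1 has numerator `+ 1 ℤ.+ + m ℤ.* + 1`, whose last factor does not
  -- reduce for a variable `m`.
  (cong (λ z → (+ 1 ℤ.+ z) ℚ./ 1) (sym (ℤ.*-identityʳ (+ m))))
  (fromℚᵘ-homo-+ ℚᵘ.1ℚᵘ (mkℚᵘ (+ m) 0))

k*1/k≡1 : ∀ k .{{_ : ℕ.NonZero k}} → + k ℚ./ 1 ℚ.* (+ 1 ℚ./ k) ≡ 1ℚ
k*1/k≡1 k@(ℕ.suc k-1) = trans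
  (sym (fromℚᵘ-homo-* p (ℚᵘ.1/ p)))
  (ℚ.fromℚᵘ-cong {p ℚᵘ.* ℚᵘ.1/ p} {ℚᵘ.1ℚᵘ} (ℚᵘ.*-inverseʳ p))
  where p = mkℚᵘ (+ k) 0

-- Transfer of inequalities between reals.

-- An error `δ` = ε/w in the first inequality becomes ε once the gap is multiplied by `w`. Every
-- inequality below thus reduces to an identity between rational gaps.
≤-rescale : ∀ {x y x′ y′} (w : ℚ) .{{_ : ℚ.Positive w}} →
            (∀ k → seq y′ k ℚ.- seq x′ k ≡ (seq y k ℚ.- seq x k) ℚ.* w) →
            x ≤ y → x′ ≤ y′
≤-rescale {x} {y} {x′} {y′} w y′-x′≡[y-x]w x≤y ε ε>0 =
  let N , hN = x≤y δ (ℚ.positive⁻¹ δ) in N , λ k k≥N → bound k (hN k k≥N)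
  where
  instance
    w≢0 = ℚ.pos⇒nonZero w
    ε⁺ = ℚ.positive ε>0
    w⁻¹⁺ = ℚ.1/pos⇒pos w
    δ⁺ = ℚ.pos*pos⇒pos ε (ℚ.1/ w)
    w≥0 = ℚ.pos⇒nonNeg w
  δ = ε ℚ.* ℚ.1/ w

  δw≡ε : δ ℚ.* w ≡ ε
  δw≡ε = trans (ℚ.*-assoc ε (ℚ.1/ w) w)
    (trans (cong (ε ℚ.*_) (ℚ.*-inverseˡ w)) (ℚ.*-identityʳ ε))

  open ℚ.≤-Reasoning

  bound : ∀ k → seq x k ℚ.≤ seq y k ℚ.+ δ → seq x′ k ℚ.≤ seq y′ k ℚ.+ ε
  bound k x≤y+δ =
    let p = seq x k ; q = seq y k ; p′ = seq x′ k ; q′ = seq y′ k in begin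
    p′
      ≡⟨ solve 3 (λ p p′ w → p′ := p :* w :+ (p′ :- p :* w)) refl p p′ w ⟩
    p ℚ.* w ℚ.+ (p′ ℚ.- p ℚ.* w)
      ≤⟨ ℚ.+-monoˡ-≤ (p′ ℚ.- p ℚ.* w) (ℚ.*-monoʳ-≤-nonNeg w x≤y+δ) ⟩
    (q ℚ.+ δ) ℚ.* w ℚ.+ (p′ ℚ.- p ℚ.* w)
      ≡⟨ solve 5 (λ p q p′ w δ → (q :+ δ) :* w :+ (p′ :- p :* w)
                              := (q :- p) :* w :+ p′ :+ δ :* w) refl p q p′ w δ ⟩
    (q ℚ.- p) ℚ.* w ℚ.+ p′ ℚ.+ δ ℚ.* w
      ≡⟨ cong₂ (λ u v → u ℚ.+ p′ ℚ.+ v) (sym (y′-x′≡[y-x]w k)) δw≡ε ⟩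
    q′ ℚ.- p′ ℚ.+ p′ ℚ.+ ε
      ≡⟨ solve 3 (λ p′ q′ ε → q′ :- p′ :+ p′ :+ ε := q′ :+ ε) refl p′ q′ ε ⟩
    q′ ℚ.+ ε ∎

-- The gap y/s - x is 1/s times the gap y - s x. The factor `1ℝ` is the γ of the final bound.
≤-/ : ∀ {x y} s .{{_ : ℕ.NonZero s}} → fromℕ s * x ≤ y → x ≤ 1ℝ * (y / s)
≤-/ {x} {y} s = ≤-rescale {fromℕ s * x} {y} {x} {1ℝ * (y / s)} w {{w⁺}} difference
  where
  σ = + s ℚ./ 1
  w = + 1 ℚ./ s
  w⁺ = ℚ.normalize-pos 1 s

  open ≡-Reasoning

  difference : ∀ k → 1ℚ ℚ.* (seq y k ℚ.* w) ℚ.- seq x k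
                   ≡ (seq y k ℚ.- σ ℚ.* seq x k) ℚ.* w
  difference k = let p = seq x k ; q = seq y k in begin
    1ℚ ℚ.* (q ℚ.* w) ℚ.- p
      -- A coefficient `1ℚ` is left on `p`, to be replaced by `σ ℚ.* w`.
      ≡⟨ solve 3 (λ p q w → con 1ℚ :* (q :* w) :- p := q :* w :- con 1ℚ :* p) refl p q w ⟩
    q ℚ.* w ℚ.- 1ℚ ℚ.* p
      ≡⟨ cong (λ u → q ℚ.* w ℚ.- u ℚ.* p) (k*1/k≡1 s) ⟨
    q ℚ.* w ℚ.- σ ℚ.* w ℚ.* p
      ≡⟨ solve 4 (λ p q w σ → q :* w :- σ :* w :* p := (q :- σ :* p) :* w) refl p q w σ ⟩
    (q ℚ.- σ ℚ.* p) ℚ.* w ∎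

-- Subsets as updates of their indicator vectors

+ˢ≡[]≔inside : ∀ (S : Subset n) i → S +ˢ i ≡ S [ i ]≔ inside
+ˢ≡[]≔inside (x ∷ S) zero    = cong₂ _∷_ (∨-zeroʳ x) (∪-identityʳ S)
+ˢ≡[]≔inside (x ∷ S) (suc i) = cong₂ _∷_ (∨-identityʳ x) (+ˢ≡[]≔inside S i)

-ˢ≡[]≔outside : ∀ (S : Subset n) i → S -ˢ i ≡ S [ i ]≔ outside
-ˢ≡[]≔outside (x ∷ S) zero    = cong (outside ∷_) (p─⊥≡p S)
-ˢ≡[]≔outside (x ∷ S) (suc i) = cong (x ∷_) (-ˢ≡[]≔outside S i)

-- Intersection and union are `zipWith` of `_∧_` and `_∨_`, so this evaluates both on sets updated
-- at the same index.
zipWith-[]≔ : ∀ {A B C : Set} (g : A → B → C) (xs : Vec A n) ys i {x y} →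
              zipWith g (xs [ i ]≔ x) (ys [ i ]≔ y) ≡ zipWith g xs ys [ i ]≔ g x y
zipWith-[]≔ g (_ ∷ xs) (_ ∷ ys) zero    = refl
zipWith-[]≔ g (x ∷ xs) (y ∷ ys) (suc i) = cong (g x y ∷_) (zipWith-[]≔ g xs ys i)

-- Comparing two updates at `i` avoids a case split on whether `i` lies in `S`.
∣S[i]≔inside∣ : ∀ (S : Subset n) i →
                ∣ S [ i ]≔ inside ∣ ≡ ℕ.suc ∣ S [ i ]≔ outside ∣
∣S[i]≔inside∣ (_       ∷ S) zero    = refl
∣S[i]≔inside∣ (inside  ∷ S) (suc i) = cong ℕ.suc (∣S[i]≔inside∣ S i)
∣S[i]≔inside∣ (outside ∷ S) (suc i) = ∣S[i]≔inside∣ S i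

-- Identities are proved between the rational terms seq x k, never between
-- reals: conversion at the record type ℝ would unfold the Cauchy proofs.

∂ : Fin n → (Subset n → ℚ) → Subset n → ℚ
∂ i g S = g (S [ i ]≔ inside) ℚ.- g (S [ i ]≔ outside)

seq-B : ∀ (f : SetFunction n) i S k → seq (B f i S) k ≡ ∂ i (λ T → seq (f T) k) S
seq-B f i S k = cong₂ (λ P Q → seq (f P) k ℚ.- seq (f Q) k)
  (+ˢ≡[]≔inside S i) (-ˢ≡[]≔outside S i)

seq-A : ∀ (f : SetFunction n) i j S k →
        seq (A f i j S) k ≡ ∂ i (∂ j (λ T → seq (f T) k)) S
seq-A f i j S k = trans
  (cong₂ (λ P Q → seq (B f j P) k ℚ.- seq (B f j Q) k)
    (+ˢ≡[]≔inside S i) (-ˢ≡[]≔outside S i))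
  (cong₂ ℚ._-_ (seq-B f j (S [ i ]≔ inside) k) (seq-B f j (S [ i ]≔ outside) k))

-- The second update at `i` overwrites the first, so `∂ i g` does not depend on membership of `i`.
∂²≡0 : ∀ i (g : Subset n → ℚ) S → ∂ i (∂ i g) S ≡ 0ℚ
∂²≡0 i g S = trans
  (cong₂ ℚ._-_ (absorb inside) (absorb outside))
  (ℚ.+-inverseʳ (∂ i g S))
  where
  absorb : ∀ x → ∂ i g (S [ i ]≔ x) ≡ ∂ i g S
  absorb x = cong₂ (λ P Q → g P ℚ.- g Q) ([]≔-idempotent S i) ([]≔-idempotent S i)

-- The case i = j.

-ˢ⊆+ˢ : ∀ (S : Subset n) i → S -ˢ i ⊆ S +ˢ i
-ˢ⊆+ˢ S i = ⊆-trans (p─q⊆p S ⁅ i ⁆) (p⊆p∪q ⁅ i ⁆)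

diagonal-bound : ∀ {f : SetFunction n} → Monotone f → ∀ S i →
                 fromℕ ∣ S ∣ * A f i i S ≤ B f i S + B f i S
diagonal-bound {f = f} mono S i =
  ≤-rescale {f (S -ˢ i)} {f (S +ˢ i)} {fromℕ ∣ S ∣ * A f i i S} {B f i S + B f i S}
    -- Since `A f i i S` vanishes termwise, the gap is 2 `B f i S`, twice the gap given by
    -- monotonicity.
    (1ℚ ℚ.+ 1ℚ) difference (mono (S -ˢ i) (S +ˢ i) (-ˢ⊆+ˢ S i))
  where
  difference : ∀ k →
    (seq (B f i S) k ℚ.+ seq (B f i S) k) ℚ.- (+ ∣ S ∣ ℚ./ 1) ℚ.* seq (A f i i S) k
      ≡ seq (B f i S) k ℚ.* (1ℚ ℚ.+ 1ℚ)
  difference k = let β = seq (B f i S) k ; σ = + ∣ S ∣ ℚ./ 1 in trans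
    (cong (λ α → (β ℚ.+ β) ℚ.- σ ℚ.* α)
      (trans (seq-A f i i S k) (∂²≡0 i (λ T → seq (f T) k) S)))
    (solve 2 (λ β σ → (β :+ β) :- σ :* con 0ℚ := β :* (con 1ℚ :+ con 1ℚ)) refl β σ)

-- The case i ≠ j.

module _ (S : Subset n) {i j : Fin n} (i≢j : i ≢ j) where

  -- The four sets R, R+i, R+j and R+i+j, indexed by membership of `i` and of `j`.
  corner : Bool → Bool → Subset n
  corner x y = S [ i ]≔ x [ j ]≔ y

  -- As i ≠ j, the update at `i` keeps the entry at `j`, and writing that entry back changes
  -- nothing.
  corner-i : ∀ x → S [ i ]≔ x ≡ corner x (lookup S j)
  corner-i x = sym (trans
    (cong (S [ i ]≔ x [ j ]≔_) (sym (lookup∘update′ (i≢j ∘ sym) S x)))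
    ([]≔-lookup (S [ i ]≔ x) j))

  corner-j : ∀ y → S [ j ]≔ y ≡ corner (lookup S i) y
  corner-j y = cong (_[ j ]≔ y) (sym ([]≔-lookup S i))

  corner-S : S ≡ corner (lookup S i) (lookup S j)
  corner-S = trans (sym ([]≔-lookup S i)) (corner-i (lookup S i))

  ∣corner∣-j : ∀ x → ∣ corner x inside ∣ ≡ ℕ.suc ∣ corner x outside ∣
  ∣corner∣-j x = ∣S[i]≔inside∣ (S [ i ]≔ x) j

  ∣corner∣-i : ∀ y → ∣ corner inside y ∣ ≡ ℕ.suc ∣ corner outside y ∣
  ∣corner∣-i y
    -- The update at `i` is moved to the outside, where the size lemma applies.
    rewrite []≔-commutes {x = inside} {y = y} S i j i≢j
          | []≔-commutes {x = outside} {y = y} S i j i≢j = ∣S[i]≔inside∣ (S [ j ]≔ y) i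

  corner-∩ : ∀ x y x′ y′ → corner x y ∩ corner x′ y′ ≡ corner (x ∧ x′) (y ∧ y′)
  corner-∩ x y x′ y′ = trans (zipWith-[]≔ _∧_ (S [ i ]≔ x) (S [ i ]≔ x′) j)
    (cong (_[ j ]≔ (y ∧ y′)) (trans (zipWith-[]≔ _∧_ S S i)
      (cong (_[ i ]≔ (x ∧ x′)) (∩-idem S))))

  corner-∪ : ∀ x y x′ y′ → corner x y ∪ corner x′ y′ ≡ corner (x ∨ x′) (y ∨ y′)
  corner-∪ x y x′ y′ = trans (zipWith-[]≔ _∨_ (S [ i ]≔ x) (S [ i ]≔ x′) j)
    (cong (_[ j ]≔ (y ∨ y′)) (trans (zipWith-[]≔ _∨_ S S i)
      (cong (_[ i ]≔ (x ∨ x′)) (∪-idem S))))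

  private
    r = ∣ corner outside outside ∣
    ρ = + r ℚ./ 1

  -- Cardinalities as polynomials in `ρ`, a form open to the ring solver.
  size : Bool → Bool → ℚ
  size outside outside = ρ
  size inside  outside = 1ℚ ℚ.+ ρ
  size outside inside  = 1ℚ ℚ.+ ρ
  size inside  inside  = 1ℚ ℚ.+ (1ℚ ℚ.+ ρ)

  ∣corner∣/1 : ∀ x y → + ∣ corner x y ∣ ℚ./ 1 ≡ size x y
  ∣corner∣/1 outside outside = refl
  ∣corner∣/1 inside  outside = trans (cong (λ m → + m ℚ./ 1) (∣corner∣-i outside)) (suc/1 r)
  ∣corner∣/1 outside inside  = trans (cong (λ m → + m ℚ./ 1) (∣corner∣-j outside)) (suc/1 r)
  ∣corner∣/1 inside  inside  = trans (cong (λ m → + m ℚ./ 1) (∣corner∣-j inside))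
    (trans (suc/1 ∣ corner inside outside ∣) (cong (1ℚ ℚ.+_) (∣corner∣/1 inside outside)))

  size-S : + ∣ S ∣ ℚ./ 1 ≡ size (lookup S i) (lookup S j)
  size-S = trans (cong (λ T → + ∣ T ∣ ℚ./ 1) corner-S) (∣corner∣/1 (lookup S i) (lookup S j))

  private
    P = corner inside outside
    Q = corner outside inside

    P∩Q≡ = corner-∩ inside outside outside inside
    P∪Q≡ = corner-∪ inside outside outside inside

  module _ (g : Subset n → ℚ) where

    ∂i≡corners : ∂ i g S ≡ g (corner inside (lookup S j)) ℚ.- g (corner outside (lookup S j))
    ∂i≡corners = cong₂ (λ T U → g T ℚ.- g U) (corner-i inside) (corner-i outside)

    ∂j≡corners : ∂ j g S ≡ g (corner (lookup S i) inside) ℚ.- g (corner (lookup S i) outside)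
    ∂j≡corners = cong₂ (λ T U → g T ℚ.- g U) (corner-j inside) (corner-j outside)

    private
      a = g P
      b = g Q
      c = g (corner inside inside)
      d = g (corner outside outside)

    submodularity-gap :
      (+ ∣ P ∣ ℚ./ 1 ℚ.* b ℚ.+ + ∣ Q ∣ ℚ./ 1 ℚ.* a)
        ℚ.- (+ ∣ P ∩ Q ∣ ℚ./ 1 ℚ.* g (P ∪ Q) ℚ.+ + ∣ P ∪ Q ∣ ℚ./ 1 ℚ.* g (P ∩ Q))
      ≡ ((1ℚ ℚ.+ ρ) ℚ.* b ℚ.+ (1ℚ ℚ.+ ρ) ℚ.* a)
        ℚ.- (ρ ℚ.* c ℚ.+ (1ℚ ℚ.+ (1ℚ ℚ.+ ρ)) ℚ.* d)
    submodularity-gap = cong₂ ℚ._-_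
      (cong₂ (λ p q → p ℚ.* b ℚ.+ q ℚ.* a) (∣corner∣/1 inside outside) (∣corner∣/1 outside inside))
      (trans
        (cong₂ (λ I U → + ∣ I ∣ ℚ./ 1 ℚ.* g U ℚ.+ + ∣ U ∣ ℚ./ 1 ℚ.* g I) P∩Q≡ P∪Q≡)
        (cong (λ u → ρ ℚ.* c ℚ.+ u ℚ.* d) (∣corner∣/1 inside inside)))

    -- Changing `x` from `outside` to `inside` raises both the difference in direction `j` and the
    -- subtracted term by (c - a) - (b - d); likewise for `y` and direction `i`. Hence the gap is
    -- the same at all four corners.
    meta-gap : ∀ x y →
      ((g (corner inside y) ℚ.- g (corner outside y))
        ℚ.+ (g (corner x inside) ℚ.- g (corner x outside)))
        ℚ.- size x y ℚ.* ((c ℚ.- a) ℚ.- (b ℚ.- d))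
      ≡ ((1ℚ ℚ.+ ρ) ℚ.* b ℚ.+ (1ℚ ℚ.+ ρ) ℚ.* a)
        ℚ.- (ρ ℚ.* c ℚ.+ (1ℚ ℚ.+ (1ℚ ℚ.+ ρ)) ℚ.* d)
    meta-gap outside outside = solve 5 (λ ρ a b c d →
      ((a :- d) :+ (b :- d)) :- ρ :* ((c :- a) :- (b :- d))
      := ((con 1ℚ :+ ρ) :* b :+ (con 1ℚ :+ ρ) :* a)
        :- (ρ :* c :+ (con 1ℚ :+ (con 1ℚ :+ ρ)) :* d))
      refl ρ a b c d
    meta-gap inside  outside = solve 5 (λ ρ a b c d →
      ((a :- d) :+ (c :- a)) :- (con 1ℚ :+ ρ) :* ((c :- a) :- (b :- d))
      := ((con 1ℚ :+ ρ) :* b :+ (con 1ℚ :+ ρ) :* a)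
        :- (ρ :* c :+ (con 1ℚ :+ (con 1ℚ :+ ρ)) :* d))
      refl ρ a b c d
    meta-gap outside inside  = solve 5 (λ ρ a b c d →
      ((c :- b) :+ (b :- d)) :- (con 1ℚ :+ ρ) :* ((c :- a) :- (b :- d))
      := ((con 1ℚ :+ ρ) :* b :+ (con 1ℚ :+ ρ) :* a)
        :- (ρ :* c :+ (con 1ℚ :+ (con 1ℚ :+ ρ)) :* d))
      refl ρ a b c d
    meta-gap inside  inside  = solve 5 (λ ρ a b c d →
      ((c :- b) :+ (c :- a)) :- (con 1ℚ :+ (con 1ℚ :+ ρ)) :* ((c :- a) :- (b :- d))
      := ((con 1ℚ :+ ρ) :* b :+ (con 1ℚ :+ ρ) :* a)
        :- (ρ :* c :+ (con 1ℚ :+ (con 1ℚ :+ ρ)) :* d))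
      refl ρ a b c d

    gap : (∂ i g S ℚ.+ ∂ j g S) ℚ.- + ∣ S ∣ ℚ./ 1 ℚ.* ∂ i (∂ j g) S
      ≡ (+ ∣ P ∣ ℚ./ 1 ℚ.* b ℚ.+ + ∣ Q ∣ ℚ./ 1 ℚ.* a)
        ℚ.- (+ ∣ P ∩ Q ∣ ℚ./ 1 ℚ.* g (P ∪ Q) ℚ.+ + ∣ P ∪ Q ∣ ℚ./ 1 ℚ.* g (P ∩ Q))
    gap = trans
      -- `∂ i (∂ j g) S` unfolds to (c - a) - (b - d), so only the first differences and the size
      -- need rewriting.
      (cong₂ ℚ._-_ (cong₂ ℚ._+_ ∂i≡corners ∂j≡corners) (cong (ℚ._* ∂ i (∂ j g) S) size-S))
      (trans (meta-gap (lookup S i) (lookup S j)) (sym submodularity-gap))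

  off-diagonal-bound : ∀ {f : SetFunction n} → ProportionallySubmodular f →
                       fromℕ ∣ S ∣ * A f i j S ≤ B f i S + B f j S
  off-diagonal-bound {f} ps = ≤-rescale
    {fromℕ ∣ P ∩ Q ∣ * f (P ∪ Q) + fromℕ ∣ P ∪ Q ∣ * f (P ∩ Q)}
    {fromℕ ∣ P ∣ * f Q + fromℕ ∣ Q ∣ * f P}
    {fromℕ ∣ S ∣ * A f i j S} {B f i S + B f j S}
    -- The gap equals that of proportional submodularity at `P` and `Q`, hence the scale 1.
    1ℚ difference (ps P Q)
    where
    difference : ∀ k →
      (seq (B f i S) k ℚ.+ seq (B f j S) k) ℚ.- + ∣ S ∣ ℚ./ 1 ℚ.* seq (A f i j S) k
      ≡ ((+ ∣ P ∣ ℚ./ 1 ℚ.* seq (f Q) k ℚ.+ + ∣ Q ∣ ℚ./ 1 ℚ.* seq (f P) k)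
        ℚ.- (+ ∣ P ∩ Q ∣ ℚ./ 1 ℚ.* seq (f (P ∪ Q)) k
          ℚ.+ + ∣ P ∪ Q ∣ ℚ./ 1 ℚ.* seq (f (P ∩ Q)) k)) ℚ.* 1ℚ
    difference k = trans
      (cong₂ ℚ._-_ (cong₂ ℚ._+_ (seq-B f i S k) (seq-B f j S k))
        (cong (+ ∣ S ∣ ℚ./ 1 ℚ.*_) (seq-A f i j S k)))
      (trans (gap (λ T → seq (f T) k)) (sym (ℚ.*-identityʳ _)))

proposition3 : (n : ℕ) (f : SetFunction n) →
    NonNegative f → Monotone f → ProportionallySubmodular f →
    MetaSubmodular 1ℝ f
proposition3 n f _ mono ps S S≢∅ i j = ≤-/ {A f i j S} {B f i S + B f j S} ∣ S ∣ (bound i j)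
  where
  instance _ = nonempty⇒nonZero S≢∅

  bound : ∀ i j → fromℕ ∣ S ∣ * A f i j S ≤ B f i S + B f j S
  bound i j with i ≟ j
  ... | yes refl = diagonal-bound {f = f} mono S i
  ... | no i≢j   = off-diagonal-bound S i≢j {f} ps
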